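{- For $n\ge 2$, let $\overline{\mathcal M}_{\neq}(n)$ be the number of MAU pairs $(u,v)$ of binary words with $|u|=|v|=n$ and $|u|_c\ne|v|_c$ for some $c\in\{a,b\}$. Then $$\overline{\mathcal M}_{\neq}(n)=2\sum_{r_2=0}^{n-2}\ \sum_{r_1=r_2+2}^{n}{}_{A}N_{O}^{B_{r_2}},$$ where, for each $(r_1,r_2)$, $A=(r_2-r_1,\,r_1-r_2)$, $O=(0,0)$ and $B_{r_2}=(r_2,\,n-r_2)$.
   Context: Let $\Sigma=\{a,b\}$. For a word $w$ and a letter $c$, $|w|_c$ denotes the number of occurrences of $c$ in $w$. Two words $x,y$ are abelian equivalent, written $x\sim_{\mathrm{abl}}y$, if $|x|_c=|y|_c$ for all $c\in\Sigma$. For words $u,v$: a pair $(x,y)$ is an internal abelian-border of $(u,v)$ if $x$ is a nonempty proper suffix of $u$, $y$ is a proper prefix of $v$, and $x\sim_{\mathrm{abl}}y$; it is an external abelian-border of $(u,v)$ if $x$ is a nonempty proper prefix of $u$, $y$ is a proper suffix of $v$, and $x\sim_{\mathrm{abl}}y$. The pair $(u,v)$ is mutually abelian-bordered (MAB) if it has both an internal and an external abelian-border, and mutually abelian-unbordered (MAU) if it has neither. A lattice path is a finite sequence of points of $\mathbb Z^2$ in which each consecutive difference is $(1,0)$ (an east step) or $(0,1)$ (a north step). The word $w(p)\in\Sigma^*$ of a lattice path $p$ records its steps in order, writing $a$ for an east step and $b$ for a north step; conversely, for a point $A\in\mathbb Z^2$ and a word $w$, $p_A(w)$ is the lattice path starting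 at $A$ whose word is $w$. For lattice paths $p,q$, $p\cap q$ denotes the set of lattice points lying on both. For distinct lattice points $A,B,C$, ${}_{A}\mathcal N_{B}^{C}$ is the set of triples $(p,q,p')$ where $p$ is a lattice path from $A$ to $C$, $q$ is a lattice path from $B$ to $C$, $p'=p_B(w(p))$, $p\cap q=\{C\}$ and $q\cap p'=\{B\}$; and ${}_{A}N_{B}^{C}=|{}_{A}\mathcal N_{B}^{C}|$. -}

module Defs where

open import Data.Integer as ℤ using (ℤ; +_)
import Data.Integer.Properties as ℤ
open import Data.Integer.Tactic.RingSolver using (solve-∀)
open import Data.List
  using (List; []; _∷_; _++_; [_]; map; filter; length; head; last; upTo;
         cartesianProduct)
open import Data.List.Membership.Propositional using (_∈_)
import Data.List.Membership.DecPropositional as DecMembership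
open import Data.List.Membership.Propositional.Properties
  using (∈-map⁺; ∈-map⁻; ∈-++⁺ˡ; ∈-++⁺ʳ; ∈-filter⁺; ∈-filter⁻;
         ∈-cartesianProduct⁺)
open import Data.List.Properties using (∷-injectiveˡ; ∷-injectiveʳ; ≡-dec)
open import Data.List.Relation.Unary.All as All using ([]; _∷_)
open import Data.List.Relation.Unary.Any using (here)
open import Data.List.Relation.Unary.Linked using (Linked; []; [-]; _∷_)
open import Data.List.Relation.Unary.Unique.Propositional using (Unique; []; _∷_)
import Data.List.Relation.Unary.Unique.Propositional.Properties as Unique
import Data.Maybe.Properties as Maybe
open import Data.Maybe using (just)
open import Data.Nat using (ℕ; zero; suc; _∸_; _≟_) renaming (_+_ to _+ℕ_)
open import Data.Nat.ListAction using (sum)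
open import Data.Product using (Σ; ∃; ∃₂; ∃-syntax; _×_; _,_; proj₁; proj₂)
import Data.Product.Properties as Product
open import Data.Sum using (inj₁; inj₂)
open import Function using (_⇔_; mk⇔; _∘_)
open import Relation.Binary.Definitions using (DecidableEquality)
open import Relation.Binary.PropositionalEquality hiding ([_])
open import Relation.Nullary using (Dec; yes; no; ¬_; ¬?; _×-dec_; _⊎-dec_; contradiction)
open import Relation.Nullary.Decidable using (map′)
open import Relation.Unary using (Decidable; _∩_; _≐_; ｛_｝)

-- `∣ P ∣` below does not depend on the choice of `elements`: two
-- repetition-free lists with the same members have the same length.
record Finite {A : Set} (P : A → Set) : Set where
  field
    elements : List A
    unique   : Unique elements
    member   : ∀ x → x ∈ elements ⇔ P x

∣_∣ : {A : Set} (P : A → Set) {{_ : Finite P}} → ℕ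
∣ _ ∣ {{fin}} = length (Finite.elements fin)

data Letter : Set where
  a b : Letter

_≟ᴸ_ : DecidableEquality Letter
a ≟ᴸ a = yes refl
a ≟ᴸ b = no λ ()
b ≟ᴸ a = no λ ()
b ≟ᴸ b = yes refl

Word : Set
Word = List Letter

occ : Letter → Word → ℕ
occ c w = length (filter (c ≟ᴸ_) w)

infix 4 _∼abl_

_∼abl_ : Word → Word → Set
x ∼abl y = ∀ c → occ c x ≡ occ c y

ProperPrefix : Word → Word → Set
ProperPrefix x w = ∃[ z ] z ≢ [] × w ≡ x ++ z

ProperSuffix : Word → Word → Set
ProperSuffix x w = ∃[ z ] z ≢ [] × w ≡ z ++ x

InternalBorder : Word → Word → Word × Word → Set
InternalBorder u v (x , y) =
  x ≢ [] × ProperSuffix x u × ProperPrefix y v × x ∼abl y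

ExternalBorder : Word → Word → Word × Word → Set
ExternalBorder u v (x , y) =
  x ≢ [] × ProperPrefix x u × ProperSuffix y v × x ∼abl y

MAU : Word → Word → Set
MAU u v = ¬ ∃ (InternalBorder u v) × ¬ ∃ (ExternalBorder u v)

𝓜̄≠ : ℕ → Word × Word → Set
𝓜̄≠ n (u , v) =
  length u ≡ n × length v ≡ n × MAU u v × (∃[ c ] occ c u ≢ occ c v)

Point : Set
Point = ℤ × ℤ

step : Letter → Point → Point
step a (x , y) = x ℤ.+ + 1 , y
step b (x , y) = x , y ℤ.+ + 1

Step : Point → Point → Set
Step P Q = ∃[ c ] Q ≡ step c P

LatticePath : List Point → Set
LatticePath = Linked Step

LatticePathFromTo : Point → Point → List Point → Set
LatticePathFromTo A C p = LatticePath p × head p ≡ just A × last p ≡ just C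

wordOf : ∀ {p} → LatticePath p → Word
wordOf []            = []
wordOf [-]           = []
wordOf ((c , _) ∷ l) = c ∷ wordOf l

pathFrom : Point → Word → List Point
pathFrom A []      = [ A ]
pathFrom A (c ∷ w) = A ∷ pathFrom (step c A) w

𝓝 : Point → Point → Point → List Point × List Point × List Point → Set
𝓝 A B C (p , q , p′) =
  Σ (LatticePathFromTo A C p) λ π →
  LatticePathFromTo B C q ×
  p′ ≡ pathFrom B (wordOf (proj₁ π)) ×
  (_∈ p) ∩ (_∈ q) ≐ ｛ C ｝ ×
  (_∈ q) ∩ (_∈ p′) ≐ ｛ B ｝

-- Empty (hence 0) when hi < lo.
∑[_⋯_] : ℕ → ℕ → (ℕ → ℕ) → ℕ
∑[ lo ⋯ hi ] f = sum (map (λ i → f (lo +ℕ i)) (upTo (suc hi ∸ lo)))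

words : ℕ → List Word
words zero    = [ [] ]
words (suc n) = map (a ∷_) (words n) ++ map (b ∷_) (words n)

words-complete : ∀ w → w ∈ words (length w)
words-complete []      = here refl
words-complete (a ∷ w) = ∈-++⁺ˡ (∈-map⁺ (a ∷_) (words-complete w))
words-complete (b ∷ w) =
  ∈-++⁺ʳ (map (a ∷_) (words (length w))) (∈-map⁺ (b ∷_) (words-complete w))

words-unique : ∀ n → Unique (words n)
words-unique zero    = [] ∷ []
words-unique (suc n) =
  Unique.++⁺ (Unique.map⁺ ∷-injectiveʳ (words-unique n))
             (Unique.map⁺ ∷-injectiveʳ (words-unique n))
             disjoint
  where
  disjoint : ∀ {w} → ¬ (w ∈ map (a ∷_) (words n) × w ∈ map (b ∷_) (words n))
  disjoint (i , j) with ∈-map⁻ (a ∷_) i | ∈-map⁻ (b ∷_) j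
  ... | _ , _ , refl | _ , _ , ()

[]? : (w : Word) → Dec (w ≡ [])
[]? w = ≡-dec _≟ᴸ_ w []

_∼abl?_ : ∀ x y → Dec (x ∼abl y)
x ∼abl? y =
  map′ (λ { (p , q) → λ { a → p ; b → q } }) (λ h → h a , h b)
       ((occ a x ≟ occ a y) ×-dec (occ b x ≟ occ b y))

split? : {Q : Word → Word → Set} → (∀ x z → Dec (Q x z)) →
         ∀ w → Dec (∃₂ λ x z → w ≡ x ++ z × Q x z)
split? Q? [] = map′ (λ q → [] , [] , refl , q)
                    (λ { ([] , [] , refl , q) → q })
                    (Q? [] [])
split? Q? (c ∷ w) =
  map′ (λ { (inj₁ q) → [] , c ∷ w , refl , q
          ; (inj₂ (x , z , refl , q)) → c ∷ x , z , refl , q })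
       (λ { ([] , _ , refl , q) → inj₁ q
          ; (_ ∷ x , z , refl , q) → inj₂ (x , z , refl , q) })
       (Q? [] (c ∷ w) ⊎-dec split? (λ x z → Q? (c ∷ x) z) w)

internal? : ∀ u v → Dec (∃ (InternalBorder u v))
internal? u v =
  map′ (λ { (z , x , e , z≢ , x≢ , y , t , e′ , t≢ , s) →
            (x , y) , x≢ , (z , z≢ , e) , (t , t≢ , e′) , s })
       (λ { ((x , y) , x≢ , (z , z≢ , e) , (t , t≢ , e′) , s) →
            z , x , e , z≢ , x≢ , y , t , e′ , t≢ , s })
       (split? (λ z x → ¬? ([]? z) ×-dec ¬? ([]? x) ×-dec
                        split? (λ y t → ¬? ([]? t) ×-dec (x ∼abl? y)) v) u)

external? : ∀ u v → Dec (∃ (ExternalBorder u v))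
external? u v =
  map′ (λ { (x , z , e , z≢ , x≢ , t , y , e′ , t≢ , s) →
            (x , y) , x≢ , (z , z≢ , e) , (t , t≢ , e′) , s })
       (λ { ((x , y) , x≢ , (z , z≢ , e) , (t , t≢ , e′) , s) →
            x , z , e , z≢ , x≢ , t , y , e′ , t≢ , s })
       (split? (λ x z → ¬? ([]? z) ×-dec ¬? ([]? x) ×-dec
                        split? (λ t y → ¬? ([]? t) ×-dec (x ∼abl? y)) v) u)

𝓜̄≠? : ∀ n → Decidable (𝓜̄≠ n)
𝓜̄≠? n (u , v) =
  (length u ≟ n) ×-dec (length v ≟ n) ×-dec
  (¬? (internal? u v) ×-dec ¬? (external? u v)) ×-dec
  map′ (λ { (inj₁ p) → a , p ; (inj₂ p) → b , p })
       (λ { (a , p) → inj₁ p ; (b , p) → inj₂ p })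
       (¬? (occ a u ≟ occ a v) ⊎-dec ¬? (occ b u ≟ occ b v))

instance
  𝓜̄≠-finite : ∀ {n} → Finite (𝓜̄≠ n)
  𝓜̄≠-finite {n} = record
    { elements = filter (𝓜̄≠? n) candidates
    ; unique   = Unique.filter⁺ (𝓜̄≠? n)
                   (Unique.cartesianProduct⁺ (words-unique n) (words-unique n))
    ; member   = λ x → mk⇔ sound (complete x)
    }
    where
    candidates : List (Word × Word)
    candidates = cartesianProduct (words n) (words n)

    sound : ∀ {x} → x ∈ filter (𝓜̄≠? n) candidates → 𝓜̄≠ n x
    sound = proj₂ ∘ ∈-filter⁻ (𝓜̄≠? n) {xs = candidates}

    complete : ∀ x → 𝓜̄≠ n x → x ∈ filter (𝓜̄≠? n) candidates
    complete (u , v) h@(refl , ∣v∣≡n , _) =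
      ∈-filter⁺ (𝓜̄≠? n)
        (∈-cartesianProduct⁺ (words-complete u)
          (subst (λ k → v ∈ words k) ∣v∣≡n (words-complete v)))
        h

_≟ᴾ_ : DecidableEquality Point
_≟ᴾ_ = Product.≡-dec ℤ._≟_ ℤ._≟_

open DecMembership _≟ᴾ_ using (_∈?_)

meet? : ∀ p q C → Dec ((_∈ p) ∩ (_∈ q) ≐ ｛ C ｝)
meet? p q C =
  map′ (λ { (h , i , j) →
            (λ { (k , l) → All.lookup h k l }) , λ { refl → i , j } })
       (λ { (f , g) →
            All.tabulate (λ k l → f (k , l)) , proj₁ (g refl) , proj₂ (g refl) })
       (All.all? (λ X → X∈q→X≡C? X) p ×-dec (C ∈? p) ×-dec (C ∈? q))
  where
  X∈q→X≡C? : ∀ X → Dec (X ∈ q → C ≡ X)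
  X∈q→X≡C? X with C ≟ᴾ X | X ∈? q
  ... | yes e | _     = yes λ _ → e
  ... | no ¬e | yes i = no λ f → ¬e (f i)
  ... | no _  | no ¬i = yes λ i → contradiction i ¬i

head-pathFrom : ∀ A w → head (pathFrom A w) ≡ just A
head-pathFrom A []      = refl
head-pathFrom A (_ ∷ _) = refl

pathFrom-latticePath : ∀ A w → LatticePath (pathFrom A w)
pathFrom-latticePath A []          = [-]
pathFrom-latticePath A (c ∷ [])    = (c , refl) ∷ [-]
pathFrom-latticePath A (c ∷ d ∷ w) =
  (c , refl) ∷ pathFrom-latticePath (step c A) (d ∷ w)

wordOf-pathFrom : ∀ A w → wordOf (pathFrom-latticePath A w) ≡ w
wordOf-pathFrom A []          = refl
wordOf-pathFrom A (c ∷ [])    = refl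
wordOf-pathFrom A (c ∷ d ∷ w) = cong (c ∷_) (wordOf-pathFrom (step c A) (d ∷ w))

pathFrom-wordOf : ∀ {A p} (l : LatticePath p) → head p ≡ just A →
                  p ≡ pathFrom A (wordOf l)
pathFrom-wordOf [-]               refl = refl
pathFrom-wordOf ((c , refl) ∷ l) refl = cong (_ ∷_) (pathFrom-wordOf l refl)

x+y-x≡y : ∀ x y → (x ℤ.+ y) ℤ.- x ≡ y
x+y-x≡y = solve-∀

x+1≢x : ∀ x → x ℤ.+ + 1 ≢ x
x+1≢x x e
  with trans (sym (x+y-x≡y x (+ 1)))
             (trans (cong (ℤ._- x) e) (ℤ.+-inverseʳ x))
... | ()

step-injective : ∀ A {c d} → step c A ≡ step d A → c ≡ d
step-injective A {a} {a} _ = refl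
step-injective A {a} {b} e = contradiction (cong proj₁ e) (x+1≢x _)
step-injective A {b} {a} e = contradiction (cong proj₂ e) (x+1≢x _)
step-injective A {b} {b} _ = refl

pathFrom-injective : ∀ A {w z} → pathFrom A w ≡ pathFrom A z → w ≡ z
pathFrom-injective A {[]}    {[]}          _ = refl
pathFrom-injective A {[]}    {_ ∷ []}      ()
pathFrom-injective A {[]}    {_ ∷ _ ∷ _}   ()
pathFrom-injective A {_ ∷ []}    {[]}      ()
pathFrom-injective A {_ ∷ _ ∷ _} {[]}      ()
pathFrom-injective A {c ∷ w} {d ∷ z}       e
  with ∷-injectiveʳ e
... | e′
  with step-injective A {c} {d}
         (Maybe.just-injective
           (trans (sym (head-pathFrom (step c A) w))
                  (trans (cong head e′) (head-pathFrom (step d A) z))))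
... | refl = cong (c ∷_) (pathFrom-injective (step c A) e′)

height : Point → ℤ
height (x , y) = x ℤ.+ y

height-step : ∀ c A → height (step c A) ≡ height A ℤ.+ + 1
height-step a (x , y) = lemma x y
  where
  lemma : ∀ x y → (x ℤ.+ + 1) ℤ.+ y ≡ (x ℤ.+ y) ℤ.+ + 1
  lemma = solve-∀
height-step b (x , y) = sym (ℤ.+-assoc x y (+ 1))

last-∷-pathFrom : ∀ X A w → last (X ∷ pathFrom A w) ≡ last (pathFrom A w)
last-∷-pathFrom X A []      = refl
last-∷-pathFrom X A (_ ∷ _) = refl

height-last : ∀ A {C} w → last (pathFrom A w) ≡ just C →
              height C ≡ height A ℤ.+ + length w
height-last A []      refl = sym (ℤ.+-identityʳ _)
height-last A {C} (c ∷ w) e = begin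
  height C                               ≡⟨ height-last (step c A) w e′ ⟩
  height (step c A) ℤ.+ + length w       ≡⟨ cong (ℤ._+ + length w) (height-step c A) ⟩
  (height A ℤ.+ + 1) ℤ.+ + length w      ≡⟨ ℤ.+-assoc (height A) (+ 1) (+ length w) ⟩
  height A ℤ.+ + suc (length w)          ∎
  where
  open ≡-Reasoning
  e′ = trans (sym (last-∷-pathFrom A (step c A) w)) e

dist : Point → Point → ℕ
dist A C = ℤ.∣ height C ℤ.- height A ∣

length-pathFrom : ∀ A {C} w → last (pathFrom A w) ≡ just C → length w ≡ dist A C
length-pathFrom A {C} w e =
  cong ℤ.∣_∣ (sym (trans (cong (ℤ._- height A) (height-last A w e))
                         (x+y-x≡y (height A) (+ length w))))

-- Holds of (w(p) , w(q)) iff (p , q , p_B(w(p))) ∈ 𝓝 A B C, for p from A and q from B.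
𝓝ʷ : Point → Point → Point → Word × Word → Set
𝓝ʷ A B C (w , z) =
  last (pathFrom A w) ≡ just C ×
  last (pathFrom B z) ≡ just C ×
  (_∈ pathFrom A w) ∩ (_∈ pathFrom B z) ≐ ｛ C ｝ ×
  (_∈ pathFrom B z) ∩ (_∈ pathFrom B w) ≐ ｛ B ｝

𝓝ʷ? : ∀ A B C → Decidable (𝓝ʷ A B C)
𝓝ʷ? A B C (w , z) =
  Maybe.≡-dec _≟ᴾ_ (last (pathFrom A w)) (just C) ×-dec
  Maybe.≡-dec _≟ᴾ_ (last (pathFrom B z)) (just C) ×-dec
  meet? (pathFrom A w) (pathFrom B z) C ×-dec
  meet? (pathFrom B z) (pathFrom B w) B

paths : Point → Point → Word × Word → List Point × List Point × List Point
paths A B (w , z) = pathFrom A w , pathFrom B z , pathFrom B w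

paths-injective : ∀ A B {x y} → paths A B x ≡ paths A B y → x ≡ y
paths-injective A B e =
  cong₂ _,_ (pathFrom-injective A (cong proj₁ e))
            (pathFrom-injective B (cong (proj₁ ∘ proj₂) e))

instance
  𝓝-finite : ∀ {A B C} → Finite (𝓝 A B C)
  𝓝-finite {A} {B} {C} = record
    { elements = map (paths A B) (filter (𝓝ʷ? A B C) candidates)
    ; unique   = Unique.map⁺ (paths-injective A B)
                   (Unique.filter⁺ (𝓝ʷ? A B C)
                     (Unique.cartesianProduct⁺ (words-unique (dist A C))
                                               (words-unique (dist B C))))
    ; member   = λ x → mk⇔ sound (complete x)
    }
    where
    candidates : List (Word × Word)
    candidates = cartesianProduct (words (dist A C)) (words (dist B C))

    sound : ∀ {x} → x ∈ map (paths A B) (filter (𝓝ʷ? A B C) candidates) →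
            𝓝 A B C x
    sound i with ∈-map⁻ (paths A B) i
    ... | (w , z) , j , refl
      with proj₂ (∈-filter⁻ (𝓝ʷ? A B C) {xs = candidates} j)
    ... | lw , lz , m , m′ =
      (pathFrom-latticePath A w , head-pathFrom A w , lw) ,
      (pathFrom-latticePath B z , head-pathFrom B z , lz) ,
      cong (pathFrom B) (sym (wordOf-pathFrom A w)) , m , m′

    complete : ∀ x → 𝓝 A B C x →
               x ∈ map (paths A B) (filter (𝓝ʷ? A B C) candidates)
    complete (p , q , _) ((l , h , e) , (l′ , h′ , e′) , refl , m , m′)
      with wordOf l | wordOf l′ | pathFrom-wordOf l h | pathFrom-wordOf l′ h′
    ... | w | z | refl | refl =
      ∈-map⁺ (paths A B)
        (∈-filter⁺ (𝓝ʷ? A B C)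
          (∈-cartesianProduct⁺
            (subst (λ k → w ∈ words k) (length-pathFrom A w e) (words-complete w))
            (subst (λ k → z ∈ words k) (length-pathFrom B z e′) (words-complete z)))
          (e , e′ , m , m′))

{-# OPTIONS --safe #-}

-- Put z = reverse v.  Borders of (u , v) are abelian-equivalent prefixes or
-- suffixes of u and z, so a pair with u ≁ v is MAU iff u and z have neither
-- nonempty abelian-equivalent prefixes nor nonempty abelian-equivalent suffixes.
-- When u and z contain r₁ and r₂ letters a, the path of u from A and the path of
-- z from O end at the same point C; their further common points are the
-- equivalent suffixes, and the common points other than O of the paths of u and
-- z from O are the equivalent prefixes.  Exchanging u and z gives the factor 2.
-- The value r₁ = r₂ + 1 does not occur: u would have to start with b and z with
-- a, and then the difference of the numbers of letters a, moving from -1 to 1 by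
-- steps of at most one, would vanish on the way.

module Submission where

open import Defs
open import Data.Nat using (ℕ; _+_; _*_; _∸_; _≥_)
open import Data.Integer using (+_; _-_)
open import Data.Product using (_,_)
open import Relation.Binary.PropositionalEquality using (_≡_)

open import Data.Integer as ℤ using (ℤ)
import Data.Integer.Properties as ℤ
open import Algebra.Properties.AbelianGroup ℤ.+-0-abelianGroup using (∙-cancelˡ; ∙-cancelʳ)
open import Data.Integer.Tactic.RingSolver using (solve-∀)
open import Data.List
  using (List; []; _∷_; _++_; map; filter; length; last; reverse; concatMap; upTo)
open import Data.List.Membership.Propositional using (_∈_; find; lose)
open import Data.List.Membership.Propositional.Properties
  using (∈-map⁺; ∈-map⁻; ∈-++⁺ˡ; ∈-++⁺ʳ; ∈-++⁻; ∈-concatMap⁺; ∈-concatMap⁻; ∈-upTo⁺; ∈-upTo⁻)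
open import Data.List.Membership.Propositional.Properties.WithK using (unique∧set⇒bag)
open import Data.List.Properties
  using (map-cong; length-map; length-++; length-reverse; filter-++; reverse-++; reverse-involutive;
         reverse-injective; ++-identityʳ)
open import Data.List.Relation.Binary.BagAndSetEquality using (∼bag⇒↭)
open import Data.List.Relation.Binary.Permutation.Propositional.Properties
  using (↭-length; ↭-reverse; filter-↭)
open import Data.List.Relation.Unary.All as All using (All; []; _∷_)
import Data.List.Relation.Unary.All.Properties as All
import Data.List.Relation.Unary.AllPairs as AllPairs
import Data.List.Relation.Unary.AllPairs.Properties as AllPairs
open import Data.List.Relation.Unary.Any using (Any; here; there)
open import Data.List.Relation.Unary.Unique.Propositional using (Unique)
import Data.List.Relation.Unary.Unique.Propositional.Properties as Unique
open import Data.Maybe using (just)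
open import Data.Maybe.Properties using (just-injective)
open import Data.Nat using (zero; suc; _≤_; _<_; z≤n; s≤s)
import Data.Nat.Properties as ℕ
open import Data.Nat.ListAction using (sum)
open import Data.Product using (Σ-syntax; ∃; ∃₂; ∃-syntax; _×_; proj₁; proj₂; map₂; swap)
open import Data.Sum using (inj₁; inj₂)
open import Function using (_⇔_; mk⇔; Equivalence; _∘_)
open import Relation.Binary.Definitions using (tri<; tri≈; tri>)
open import Relation.Binary.PropositionalEquality hiding (_≡_)
open import Relation.Nullary using (¬_; yes; no; contradiction)
open import Relation.Unary using (_∪_; _∩_; _≐_; ｛_｝)

open Equivalence using (to; from)

-- Cardinalities of finite predicates

-- Keeps a count together with the enumeration that yields it: the lists built here differ from
-- those of the instances that the theorem counts with.
HasSize : {A : Set} → (A → Set) → ℕ → Set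
HasSize P k = Σ[ fin ∈ Finite P ] ∣ P ∣ {{fin}} ≡ k

-- In repetition-free lists, equal membership means equal multiplicities, so the two lists are
-- permutations of each other. This carries the constructed count over to the instance `𝓜̄≠-finite`.
size-unique : ∀ {A : Set} {P Q : A → Set} {k l} →
              P ≐ Q → HasSize P k → HasSize Q l → k ≡ l
size-unique (P⊆Q , Q⊆P) (F , refl) (G , refl) =
  ↭-length (∼bag⇒↭ (unique∧set⇒bag (unique F) (unique G) (λ {x} →
    mk⇔ (from (member G x) ∘ P⊆Q ∘ to (member F x))
        (from (member F x) ∘ Q⊆P ∘ to (member G x)))))
  where open Finite

size-≐ : ∀ {A : Set} {P Q : A → Set} {k} → P ≐ Q → HasSize P k → HasSize Q k
size-≐ (P⊆Q , Q⊆P) (F , e) = record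
  { elements = elements F
  ; unique   = unique F
  ; member   = λ x → mk⇔ (P⊆Q ∘ to (member F x)) (from (member F x) ∘ Q⊆P)
  } , e
  where open Finite

unmap : ∀ {A B : Set} {f : A → B} {ys} →
        All (λ y → ∃[ x ] f x ≡ y) ys → ∃[ xs ] map f xs ≡ ys
unmap []               = [] , refl
unmap ((x , refl) ∷ h) with xs , refl ← unmap h = x ∷ xs , refl

-- Every listed element has a preimage, so the list is `map f xs` and `xs` enumerates the preimage.
-- Preimages are asked for on `Q` alone because `paths A O` does not reach all triples of point
-- lists.
size-preimage : ∀ {A B : Set} {Q : B → Set} {k} (f : A → B) →
                (∀ {x y} → f x ≡ f y → x ≡ y) → (∀ {y} → Q y → ∃[ x ] f x ≡ y) →
                HasSize Q k → HasSize (Q ∘ f) k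
size-preimage f f-inj onto
  (record { elements = ys ; unique = ys! ; member = ∈ys⇔Q } , e)
  with xs , refl ← unmap (All.tabulate {xs = ys} (λ {y} → onto ∘ to (∈ys⇔Q y)))
  = record
    { elements = xs
    ; unique   = Unique.map⁻ ys!
    ; member   = λ x → mk⇔ (to (∈ys⇔Q (f x)) ∘ ∈-map⁺ f) (∈xs x ∘ from (∈ys⇔Q (f x)))
    } , trans (sym (length-map f xs)) e
  where
  ∈xs : ∀ {xs} x → f x ∈ map f xs → x ∈ xs
  ∈xs {xs} x fx∈ with x′ , x′∈xs , fx≡fx′ ← ∈-map⁻ f fx∈ =
    subst (_∈ xs) (f-inj (sym fx≡fx′)) x′∈xs

size-∪ : ∀ {A : Set} {P Q : A → Set} {k l} → (∀ {x} → P x → ¬ Q x) →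
         HasSize P k → HasSize Q l → HasSize (P ∪ Q) (k + l)
size-∪ {P = P} {Q} disjoint (F , refl) (G , refl) = record
  { elements = elements F ++ elements G
  ; unique   = Unique.++⁺ (unique F) (unique G)
                 (λ (x∈F , x∈G) → disjoint (to (member F _) x∈F) (to (member G _) x∈G))
  ; member   = λ x → mk⇔ sound complete
  } , length-++ (elements F)
  where
  open Finite

  sound : ∀ {x} → x ∈ elements F ++ elements G → (P ∪ Q) x
  sound x∈ with ∈-++⁻ (elements F) x∈
  ... | inj₁ x∈F = inj₁ (to (member F _) x∈F)
  ... | inj₂ x∈G = inj₂ (to (member G _) x∈G)

  complete : ∀ {x} → (P ∪ Q) x → x ∈ elements F ++ elements G
  complete (inj₁ p) = ∈-++⁺ˡ (from (member F _) p)
  complete (inj₂ q) = ∈-++⁺ʳ (elements F) (from (member G _) q)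

⋃[_⋯_] : {A : Set} → ℕ → ℕ → (ℕ → A → Set) → A → Set
⋃[ lo ⋯ hi ] P x = ∃[ i ] lo ≤ i × i ≤ hi × P i x

length-concatMap : ∀ {A B : Set} (f : A → List B) xs →
                   length (concatMap f xs) ≡ sum (map (length ∘ f) xs)
length-concatMap f []       = refl
length-concatMap f (x ∷ xs) =
  trans (length-++ (f x)) (cong (λ k → length (f x) + k) (length-concatMap f xs))

unique-concatMap : ∀ {A B : Set} {f : A → List B} → (∀ x → Unique (f x)) →
                   (∀ {x x′ y} → y ∈ f x → y ∈ f x′ → x ≡ x′) →
                   ∀ {xs} → Unique xs → Unique (concatMap f xs)
unique-concatMap {f = f} f! disjoint {xs} xs! =
  Unique.concat⁺ (All.map⁺ (All.universal f! xs))
    (AllPairs.map⁺ (AllPairs.map (λ x≢x′ {_} (i , j) → x≢x′ (disjoint i j)) xs!))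

size-⋃ : ∀ {A : Set} {P : ℕ → A → Set} {k : ℕ → ℕ} lo hi →
         (∀ {i j x} → P i x → P j x → i ≡ j) → (∀ i → HasSize (P i) (k i)) →
         HasSize (⋃[ lo ⋯ hi ] P) (∑[ lo ⋯ hi ] k)
size-⋃ {A} {P} {k} lo hi disjoint size = record
  { elements = concatMap layer range
  ; unique   = unique-concatMap (λ i → Finite.unique (fin i))
                 (λ x∈i x∈j → ℕ.+-cancelˡ-≡ lo _ _
                   (disjoint (to (Finite.member (fin _) _) x∈i)
                             (to (Finite.member (fin _) _) x∈j)))
                 (Unique.upTo⁺ (suc hi ∸ lo))
  ; member   = λ x → mk⇔ (sound ∘ ∈-concatMap⁻ layer) (∈-concatMap⁺ layer ∘ complete)
  } , trans (length-concatMap layer range)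
            (cong sum (map-cong (λ i → proj₂ (size (lo + i))) range))
  where
  range : List ℕ
  range = upTo (suc hi ∸ lo)

  fin : ∀ i → Finite (P (lo + i))
  fin i = proj₁ (size (lo + i))

  layer : ℕ → List A
  layer i = Finite.elements (fin i)

  -- The hypothesis makes the truncated difference nonzero, hence `lo ≤ suc hi`, and only then may
  -- `lo` be moved across the subtraction.
  bound : ∀ {i} → i < suc hi ∸ lo → i + lo < suc hi
  bound {i} i< = ℕ.m≤o∸n⇒m+n≤o (suc i) (ℕ.<⇒≤ (ℕ.m∸n≢0⇒n<m (ℕ.m<n⇒n≢0 i<))) i<

  sound : ∀ {x} → Any ((x ∈_) ∘ layer) range → (⋃[ lo ⋯ hi ] P) x
  sound any with i , i∈range , x∈i ← find any =
    lo + i , ℕ.m≤m+n lo i ,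
    ℕ.≤-pred (subst (_≤ suc hi) (cong suc (ℕ.+-comm i lo)) (bound (∈-upTo⁻ i∈range))) ,
    to (Finite.member (fin i) _) x∈i

  complete : ∀ {x} → (⋃[ lo ⋯ hi ] P) x → Any ((x ∈_) ∘ layer) range
  complete {x} (i , lo≤i , i≤hi , p) =
    lose (∈-upTo⁺ (ℕ.∸-monoˡ-< (s≤s i≤hi) lo≤i))
      (from (Finite.member (fin (i ∸ lo)) x)
        (subst (λ j → P j x) (sym (ℕ.m+[n∸m]≡n lo≤i)) p))

-- Occurrences and abelian equivalence

occ-++ : ∀ c x y → occ c (x ++ y) ≡ occ c x + occ c y
occ-++ c x y = trans (cong length (filter-++ (c ≟ᴸ_) x y)) (length-++ (filter (c ≟ᴸ_) x))

occ-reverse : ∀ c x → occ c (reverse x) ≡ occ c x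
occ-reverse c x = ↭-length (filter-↭ (c ≟ᴸ_) (↭-reverse x))

length-occ : ∀ w → length w ≡ occ a w + occ b w
length-occ []      = refl
length-occ (a ∷ w) = cong suc (length-occ w)
length-occ (b ∷ w) = trans (cong suc (length-occ w)) (sym (ℕ.+-suc _ _))

occ≤length : ∀ w → occ a w ≤ length w
occ≤length w = subst (occ a w ≤_) (sym (length-occ w)) (ℕ.m≤m+n _ _)

∼⇒length : ∀ x y → x ∼abl y → length x ≡ length y
∼⇒length x y s =
  trans (length-occ x) (trans (cong₂ _+_ (s a) (s b)) (sym (length-occ y)))

length⇒∼ : ∀ x y → length x ≡ length y → occ a x ≡ occ a y → x ∼abl y
length⇒∼ x y ∣x∣≡∣y∣ e a = e
length⇒∼ x y ∣x∣≡∣y∣ e b = ℕ.+-cancelˡ-≡ (occ a x) _ _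
  (trans (sym (length-occ x))
    (trans ∣x∣≡∣y∣ (trans (length-occ y) (cong (_+ occ b y) (sym e)))))

length-[] : ∀ {A : Set} {x : List A} → length x ≡ 0 → x ≡ []
length-[] {x = []} _ = refl

length-≡-[] : ∀ {A : Set} {x y : List A} → length x ≡ length y → x ≡ [] → y ≡ []
length-≡-[] e refl = length-[] (sym e)

-- Words without abelian-equivalent prefixes or suffixes

-- The matched prefixes may be whole words, as suits common points of paths; `proper-prefixes`
-- excludes this for inequivalent words of equal length. Emptiness of `x` carries over to `y`, which
-- has the same length.
PrefixFree : Word → Word → Set
PrefixFree w z = ∀ x x′ y y′ → w ≡ x ++ x′ → z ≡ y ++ y′ → x ∼abl y → x ≡ []

SuffixFree : Word → Word → Set
SuffixFree w z = ∀ x x′ y y′ → w ≡ x ++ x′ → z ≡ y ++ y′ → x′ ∼abl y′ → x′ ≡ []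

Unmatched : Word → Word → Set
Unmatched w z = PrefixFree w z × SuffixFree w z

prefixFree-sym : ∀ {w z} → PrefixFree w z → PrefixFree z w
prefixFree-sym free x x′ y y′ e e′ s =
  length-≡-[] (sym (∼⇒length x y s)) (free y y′ x x′ e′ e (sym ∘ s))

suffixFree-sym : ∀ {w z} → SuffixFree w z → SuffixFree z w
suffixFree-sym free x x′ y y′ e e′ s =
  length-≡-[] (sym (∼⇒length x′ y′ s)) (free y y′ x x′ e′ e (sym ∘ s))

unmatched-sym : ∀ {w z} → Unmatched w z → Unmatched z w
unmatched-sym (pre , suf) = prefixFree-sym pre , suffixFree-sym suf

-- A discrete intermediate value argument: `m` is the lead in letters `a` still to be gained by `w`
-- over `z`. The whole words gain at least `m`, and each pair of letters changes the lead by at most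
-- one, so the value `m` is attained exactly.
crossing : ∀ m w z → length w ≡ length z → m + occ a z ≤ occ a w →
           ∃₂ λ x x′ → ∃₂ λ y y′ → w ≡ x ++ x′ × z ≡ y ++ y′ ×
           length x ≡ length y × occ a x ≡ m + occ a y
crossing zero    w       z       _ _ = [] , w , [] , z , refl , refl , refl , refl
crossing (suc m) (a ∷ w) (a ∷ z) e h
  with x , x′ , y , y′ , refl , refl , l , o ←
         crossing (suc m) w z (ℕ.suc-injective e)
           (ℕ.≤-pred (subst (_≤ suc (occ a w)) (cong suc (ℕ.+-suc m _)) h))
  = a ∷ x , x′ , a ∷ y , y′ , refl , refl , cong suc l ,
    trans (cong suc o) (sym (cong suc (ℕ.+-suc m _)))
crossing (suc m) (b ∷ w) (b ∷ z) e h
  with x , x′ , y , y′ , refl , refl , l , o ← crossing (suc m) w z (ℕ.suc-injective e) h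
  = b ∷ x , x′ , b ∷ y , y′ , refl , refl , cong suc l , o
crossing (suc m) (a ∷ w) (b ∷ z) e h
  with x , x′ , y , y′ , refl , refl , l , o ←
         crossing m w z (ℕ.suc-injective e) (ℕ.≤-pred h)
  = a ∷ x , x′ , b ∷ y , y′ , refl , refl , cong suc l , cong suc o
-- Here `z` gains a letter `a`, so the rest of `w` has one more to make up.
crossing (suc m) (b ∷ w) (a ∷ z) e h
  with x , x′ , y , y′ , refl , refl , l , o ←
         crossing (suc (suc m)) w z (ℕ.suc-injective e)
           (subst (_≤ occ a w) (cong suc (ℕ.+-suc m _)) h)
  = b ∷ x , x′ , a ∷ y , y′ , refl , refl , cong suc l ,
    trans o (cong suc (sym (ℕ.+-suc m _)))

unmatched⇒gap : ∀ w z → Unmatched w z → length w ≡ length z → 2 ≤ length w →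
                occ a w ≢ suc (occ a z)
unmatched⇒gap (a ∷ w) (a ∷ z) (pre , _) _ _ _
  with () ← pre (a ∷ []) w (a ∷ []) z refl refl (λ _ → refl)
unmatched⇒gap (b ∷ w) (b ∷ z) (pre , _) _ _ _
  with () ← pre (b ∷ []) w (b ∷ []) z refl refl (λ _ → refl)
-- The first letters account for the whole gap, so the tails are equivalent suffixes; length at
-- least two makes them nonempty. For the one-letter words `a` and `b` the gap is indeed one.
unmatched⇒gap (a ∷ w) (b ∷ z) (_ , suf) e (s≤s 1≤∣w∣) o
  with refl ← suf (a ∷ []) w (b ∷ []) z refl refl
                (length⇒∼ w z (ℕ.suc-injective e) (ℕ.suc-injective o))
  with () ← 1≤∣w∣
-- The tail of the first word leads by two. Prefixes of the tails with a lead of exactly one cancel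
-- the deficit left by the first letters.
unmatched⇒gap (b ∷ w) (a ∷ z) (pre , _) e _ o
  with x , x′ , y , y′ , refl , refl , l , o′ ←
         crossing 1 w z (ℕ.suc-injective e) (ℕ.≤-trans (ℕ.n≤1+n _) (ℕ.≤-reflexive (sym o)))
  with () ← pre (b ∷ x) x′ (a ∷ y) y′ refl refl (length⇒∼ (b ∷ x) (a ∷ y) (cong suc l) o′)

-- Lattice paths

infixl 6 _⊕_

-- The endpoint of `pathFrom A w`. It depends only on letter counts, so two words lead from a common
-- start to the same point exactly when they are abelian equivalent.
_⊕_ : Point → Word → Point
(x , y) ⊕ w = x ℤ.+ + occ a w , y ℤ.+ + occ b w

⊕-identityʳ : ∀ A → A ⊕ [] ≡ A
⊕-identityʳ (x , y) = cong₂ _,_ (ℤ.+-identityʳ x) (ℤ.+-identityʳ y)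

⊕-++ : ∀ A x y → A ⊕ (x ++ y) ≡ A ⊕ x ⊕ y
⊕-++ (i , j) x y = cong₂ _,_ (shift i a) (shift j b)
  where
  shift : ∀ i c → i ℤ.+ + occ c (x ++ y) ≡ i ℤ.+ + occ c x ℤ.+ + occ c y
  shift i c = trans (cong (λ k → i ℤ.+ + k) (occ-++ c x y))
                    (sym (ℤ.+-assoc i (+ occ c x) (+ occ c y)))

⊕-∷ : ∀ A c w → step c A ⊕ w ≡ A ⊕ (c ∷ w)
⊕-∷ (x , y) a w = cong (_, _) (ℤ.+-assoc x (+ 1) (+ occ a w))
⊕-∷ (x , y) b w = cong (_ ,_) (ℤ.+-assoc y (+ 1) (+ occ b w))

⊕-congʳ : ∀ A x y → x ∼abl y → A ⊕ x ≡ A ⊕ y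
⊕-congʳ (i , j) x y s = cong₂ (λ k l → i ℤ.+ + k , j ℤ.+ + l) (s a) (s b)

⊕-cancelˡ : ∀ A x y → A ⊕ x ≡ A ⊕ y → x ∼abl y
⊕-cancelˡ (i , j) x y e a = ℤ.+-injective (∙-cancelˡ i _ _ (cong proj₁ e))
⊕-cancelˡ (i , j) x y e b = ℤ.+-injective (∙-cancelˡ j _ _ (cong proj₂ e))

⊕-cancelʳ : ∀ A B x y → x ∼abl y → A ⊕ x ≡ B ⊕ y → A ≡ B
⊕-cancelʳ A B x y s e with trans e (⊕-congʳ B y x (sym ∘ s))
... | e′ = cong₂ _,_ (∙-cancelʳ _ _ _ (cong proj₁ e′)) (∙-cancelʳ _ _ _ (cong proj₂ e′))

⊕≡⇒[] : ∀ A x → A ⊕ x ≡ A → x ≡ []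
⊕≡⇒[] A x e = length-[] (∼⇒length x [] (⊕-cancelˡ A x [] (trans e (sym (⊕-identityʳ A)))))

last-pathFrom : ∀ A w → last (pathFrom A w) ≡ just (A ⊕ w)
last-pathFrom A []      = cong just (sym (⊕-identityʳ A))
last-pathFrom A (c ∷ w) =
  trans (last-∷-pathFrom A (step c A) w)
    (trans (last-pathFrom (step c A) w) (cong just (⊕-∷ A c w)))

-- Together with `∈-pathFrom⁻`, this turns questions about common points of paths into questions
-- about factorizations of their words.
∈-pathFrom⁺ : ∀ A x y → A ⊕ x ∈ pathFrom A (x ++ y)
∈-pathFrom⁺ A []      []      = here (⊕-identityʳ A)
∈-pathFrom⁺ A []      (_ ∷ _) = here (⊕-identityʳ A)
∈-pathFrom⁺ A (c ∷ x) y       =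
  there (subst (_∈ pathFrom (step c A) (x ++ y)) (⊕-∷ A c x) (∈-pathFrom⁺ (step c A) x y))

∈-pathFrom⁻ : ∀ A w {X} → X ∈ pathFrom A w → ∃₂ λ x y → w ≡ x ++ y × X ≡ A ⊕ x
∈-pathFrom⁻ A []      (here refl) = [] , [] , refl , sym (⊕-identityʳ A)
∈-pathFrom⁻ A (c ∷ w) (here refl) = [] , c ∷ w , refl , sym (⊕-identityʳ A)
∈-pathFrom⁻ A (c ∷ w) (there X∈)
  with x , y , refl , e ← ∈-pathFrom⁻ (step c A) w X∈ = c ∷ x , y , refl , trans e (⊕-∷ A c x)

-- A common point `B ⊕ x ≡ B ⊕ y` is reached from the shared start by equivalent prefixes, and it is
-- `B` itself exactly when they are empty.
meet-start : ∀ B w z →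
             (_∈ pathFrom B w) ∩ (_∈ pathFrom B z) ≐ ｛ B ｝ ⇔ PrefixFree w z
meet-start B w z = mk⇔ only free
  where
  only : (_∈ pathFrom B w) ∩ (_∈ pathFrom B z) ≐ ｛ B ｝ → PrefixFree w z
  only (⊆B , _) x x′ y y′ refl refl s = ⊕≡⇒[] B x (sym (⊆B
    (∈-pathFrom⁺ B x x′ ,
     subst (_∈ pathFrom B z) (⊕-congʳ B y x (sym ∘ s)) (∈-pathFrom⁺ B y y′))))

  free : PrefixFree w z → (_∈ pathFrom B w) ∩ (_∈ pathFrom B z) ≐ ｛ B ｝
  free h = (λ (X∈p , X∈q) → ⊆B X∈p X∈q) , λ { refl → B∈ w , B∈ z }
    where
    B∈ : ∀ v → B ∈ pathFrom B v
    B∈ v = subst (_∈ pathFrom B v) (⊕-identityʳ B) (∈-pathFrom⁺ B [] v)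

    ⊆B : ∀ {X} → X ∈ pathFrom B w → X ∈ pathFrom B z → B ≡ X
    ⊆B X∈p X∈q
      with x , x′ , w≡ , refl ← ∈-pathFrom⁻ B w X∈p
         | y , y′ , z≡ , e    ← ∈-pathFrom⁻ B z X∈q
      with refl ← h x x′ y y′ w≡ z≡ (⊕-cancelˡ B x y e)
      = sym (⊕-identityʳ B)

-- From a common point both paths still have the same displacement to `C`, so the remaining suffixes
-- are equivalent. Conversely, cancelling equivalent suffixes from the shared end gives a common
-- point.
meet-end : ∀ A B {C} w z → A ⊕ w ≡ C → B ⊕ z ≡ C →
           (_∈ pathFrom A w) ∩ (_∈ pathFrom B z) ≐ ｛ C ｝ ⇔ SuffixFree w z
meet-end A B {C} w z A⊕w≡C B⊕z≡C = mk⇔ only free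
  where
  ends : ∀ x x′ y y′ → w ≡ x ++ x′ → z ≡ y ++ y′ → A ⊕ x ⊕ x′ ≡ B ⊕ y ⊕ y′
  ends x x′ y y′ refl refl =
    trans (sym (⊕-++ A x x′)) (trans A⊕w≡C (trans (sym B⊕z≡C) (⊕-++ B y y′)))

  only : (_∈ pathFrom A w) ∩ (_∈ pathFrom B z) ≐ ｛ C ｝ → SuffixFree w z
  only (⊆C , _) x x′ y y′ refl refl s = ⊕≡⇒[] (A ⊕ x) x′
    (trans (sym (⊕-++ A x x′)) (trans A⊕w≡C (⊆C
      (∈-pathFrom⁺ A x x′ ,
       subst (_∈ pathFrom B z)
         (sym (⊕-cancelʳ (A ⊕ x) (B ⊕ y) x′ y′ s (ends x x′ y y′ refl refl)))
         (∈-pathFrom⁺ B y y′)))))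

  free : SuffixFree w z → (_∈ pathFrom A w) ∩ (_∈ pathFrom B z) ≐ ｛ C ｝
  free h = (λ (X∈p , X∈q) → ⊆C X∈p X∈q) , λ { refl → end∈ A w A⊕w≡C , end∈ B z B⊕z≡C }
    where
    end∈ : ∀ D v → D ⊕ v ≡ C → C ∈ pathFrom D v
    end∈ D v e =
      subst₂ _∈_ e (cong (pathFrom D) (++-identityʳ v)) (∈-pathFrom⁺ D v [])

    ⊆C : ∀ {X} → X ∈ pathFrom A w → X ∈ pathFrom B z → C ≡ X
    ⊆C X∈p X∈q
      with x , x′ , w≡ , refl ← ∈-pathFrom⁻ A w X∈p
         | y , y′ , z≡ , e    ← ∈-pathFrom⁻ B z X∈q
      with refl ← h x x′ y y′ w≡ z≡
             (⊕-cancelˡ (A ⊕ x) x′ y′ (trans (ends x x′ y y′ w≡ z≡) (cong (_⊕ y′) (sym e))))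
      = trans (sym A⊕w≡C) (cong (A ⊕_) (trans w≡ (++-identityʳ x)))

-- Coordinates of the endpoints

O : Point
O = + 0 , + 0

-- For `r = r₂` and `s = r₁` this is the point `A` of the theorem. The shift makes a word with `s`
-- letters `a` end in the same column as a word with `r` of them read from `O`.
shifted : ℕ → ℕ → Point
shifted r s = + r - + s , + s - + r

target : ℕ → ℕ → Point
target n r = + r , + n - + r

-- The first coordinate determines `occ a w`; the second then says `s + occ b w ≡ n`, which is the
-- length.
endpoint : ∀ n r s w → shifted r s ⊕ w ≡ target n r ⇔ (length w ≡ n × occ a w ≡ s)
endpoint n r s w = mk⇔ counts reaches
  where
  horizontal : ∀ r s x → x ≡ (r - s ℤ.+ x) ℤ.+ s - r
  horizontal = solve-∀

  vertical : ∀ r s y → s ℤ.+ y ≡ (s - r ℤ.+ y) ℤ.+ r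
  vertical = solve-∀

  r+s-r : ∀ r s → r ℤ.+ s - r ≡ s
  r+s-r = solve-∀

  n-r+r : ∀ n r → n - r ℤ.+ r ≡ n
  n-r+r = solve-∀

  r-s+s : ∀ r s → r - s ℤ.+ s ≡ r
  r-s+s = solve-∀

  s-r+y : ∀ r s y → s - r ℤ.+ y ≡ s ℤ.+ y - r
  s-r+y = solve-∀

  counts : shifted r s ⊕ w ≡ target n r → length w ≡ n × occ a w ≡ s
  counts e = ∣w∣≡n , ∣w∣ₐ≡s
    where
    ∣w∣ₐ≡s : occ a w ≡ s
    ∣w∣ₐ≡s = ℤ.+-injective
      (trans (horizontal (+ r) (+ s) (+ occ a w))
        (trans (cong (λ k → k ℤ.+ + s - + r) (cong proj₁ e)) (r+s-r (+ r) (+ s))))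

    ∣w∣≡n : length w ≡ n
    ∣w∣≡n = trans (length-occ w) (trans (cong (_+ occ b w) ∣w∣ₐ≡s)
      (ℤ.+-injective (trans (vertical (+ r) (+ s) (+ occ b w))
        (trans (cong (ℤ._+ + r) (cong proj₂ e)) (n-r+r (+ n) (+ r))))))

  reaches : length w ≡ n × occ a w ≡ s → shifted r s ⊕ w ≡ target n r
  reaches (refl , refl) = cong₂ _,_ (r-s+s (+ r) (+ s))
    (trans (s-r+y (+ r) (+ s) (+ occ b w))
           (cong (λ k → + k - + r) (sym (length-occ w))))

-- The case `s = r` of `endpoint`: both coordinates of `shifted r r` are `r - r`.
endpoint-O : ∀ n r z → O ⊕ z ≡ target n r ⇔ (length z ≡ n × occ a z ≡ r)
endpoint-O n r z = subst (λ P → P ⊕ z ≡ target n r ⇔ (length z ≡ n × occ a z ≡ r))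
  (cong₂ _,_ (ℤ.+-inverseʳ (+ r)) (ℤ.+-inverseʳ (+ r))) (endpoint n r r z)

-- Path triples as pairs of words

𝓝-onto : ∀ {A B C t} → 𝓝 A B C t → ∃[ x ] paths A B x ≡ t
𝓝-onto ((l , h , _) , (l′ , h′ , _) , refl , _) =
  (wordOf l , wordOf l′) ,
  cong₂ (λ p q → p , q , _) (sym (pathFrom-wordOf l h)) (sym (pathFrom-wordOf l′ h′))

𝓝-paths : ∀ A B C w z → 𝓝 A B C (paths A B (w , z)) ⇔ 𝓝ʷ A B C (w , z)
𝓝-paths A B C w z = mk⇔
  (λ ((_ , _ , e) , (_ , _ , e′) , _ , m , m′) → e , e′ , m , m′)
  (λ (e , e′ , m , m′) →
    (pathFrom-latticePath A w , head-pathFrom A w , e) ,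
    (pathFrom-latticePath B z , head-pathFrom B z , e′) ,
    cong (pathFrom B) (sym (wordOf-pathFrom A w)) , m , m′)

Cell : ℕ → ℕ → ℕ → Word × Word → Set
Cell n r₂ r₁ (w , z) =
  (length w ≡ n × occ a w ≡ r₁) × (length z ≡ n × occ a z ≡ r₂) × Unmatched w z

-- `meet-end` reads the intersection at `C` as suffix-freeness, and `meet-start` reads the one at
-- `O` as prefix-freeness. The latter lists `z` before `w`, whence `prefixFree-sym`.
𝓝ʷ-cell : ∀ n r₂ r₁ → 𝓝ʷ (shifted r₂ r₁) O (target n r₂) ≐ Cell n r₂ r₁
𝓝ʷ-cell n r₂ r₁ = cell , path
  where
  A = shifted r₂ r₁
  C = target n r₂

  cell : ∀ {x} → 𝓝ʷ A O C x → Cell n r₂ r₁ x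
  cell {w , z} (e , e′ , m , m′) =
    to (endpoint n r₂ r₁ w) p , to (endpoint-O n r₂ z) q ,
    prefixFree-sym (to (meet-start O z w) m′) , to (meet-end A O w z p q) m
    where
    p = just-injective (trans (sym (last-pathFrom A w)) e)
    q = just-injective (trans (sym (last-pathFrom O z)) e′)

  path : ∀ {x} → Cell n r₂ r₁ x → 𝓝ʷ A O C x
  path {w , z} (c , c′ , pre , suf) =
    trans (last-pathFrom A w) (cong just p) , trans (last-pathFrom O z) (cong just q) ,
    from (meet-end A O w z p q) suf , from (meet-start O z w) (prefixFree-sym pre)
    where
    p = from (endpoint n r₂ r₁ w) c
    q = from (endpoint-O n r₂ z) c′

size-cell : ∀ n r₂ r₁ →
            HasSize (Cell n r₂ r₁) ∣ 𝓝 (shifted r₂ r₁) O (target n r₂) ∣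
size-cell n r₂ r₁ =
  size-≐ ((λ {x} → proj₁ (𝓝ʷ-cell n r₂ r₁) ∘ to (𝓝-paths A O C (proj₁ x) (proj₂ x))) ,
          (λ {x} → from (𝓝-paths A O C (proj₁ x) (proj₂ x)) ∘ proj₂ (𝓝ʷ-cell n r₂ r₁)))
    (size-preimage (paths A O) (paths-injective A O) 𝓝-onto (𝓝-finite , refl))
  where
  A = shifted r₂ r₁
  C = target n r₂

-- Summation over the numbers of letters `a`

Ordered : ℕ → Word × Word → Set
Ordered n (w , z) = length w ≡ n × length z ≡ n × Unmatched w z × occ a z < occ a w

-- The index ranges lose no pair: `unmatched⇒gap` rules out a gap of one, and `r₂ + 2 ≤ r₁ ≤ n`
-- gives the upper bound on `r₂`.
cells≐ordered : ∀ n → 2 ≤ n →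
                ⋃[ 0 ⋯ n ∸ 2 ] (λ r₂ → ⋃[ r₂ + 2 ⋯ n ] (Cell n r₂)) ≐ Ordered n
cells≐ordered n 2≤n = order , cell
  where
  order : ∀ {x} → (⋃[ 0 ⋯ n ∸ 2 ] (λ r₂ → ⋃[ r₂ + 2 ⋯ n ] (Cell n r₂))) x → Ordered n x
  order (r₂ , _ , _ , r₁ , r₂+2≤r₁ , _ , (∣w∣ , refl) , (∣z∣ , refl) , free) =
    ∣w∣ , ∣z∣ , free , ℕ.<-≤-trans (ℕ.m<m+n r₂ (s≤s z≤n)) r₂+2≤r₁

  cell : ∀ {x} → Ordered n x → (⋃[ 0 ⋯ n ∸ 2 ] (λ r₂ → ⋃[ r₂ + 2 ⋯ n ] (Cell n r₂))) x
  cell {w , z} (refl , ∣z∣ , free , lt) =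
    occ a z , z≤n , r₂≤n-2 , occ a w , r₂+2≤r₁ , occ≤length w ,
    (refl , refl) , (∣z∣ , refl) , free
    where
    r₂+2≤r₁ : occ a z + 2 ≤ occ a w
    r₂+2≤r₁ = subst (_≤ occ a w) (ℕ.+-comm 2 (occ a z))
      (ℕ.≤∧≢⇒< lt (≢-sym (unmatched⇒gap w z free (sym ∣z∣) 2≤n)))

    r₂≤n-2 : occ a z ≤ length w ∸ 2
    r₂≤n-2 = ℕ.m+n≤o⇒m≤o∸n (occ a z) (ℕ.≤-trans r₂+2≤r₁ (occ≤length w))

size-ordered : ∀ n → 2 ≤ n →
  HasSize (Ordered n)
    (∑[ 0 ⋯ n ∸ 2 ] (λ r₂ → ∑[ r₂ + 2 ⋯ n ] (λ r₁ →
      ∣ 𝓝 (shifted r₂ r₁) O (target n r₂) ∣)))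
size-ordered n 2≤n = size-≐ (cells≐ordered n 2≤n)
  (size-⋃ 0 (n ∸ 2)
    -- Layers are disjoint because each index is a letter count of the pair.
    (λ (_ , _ , _ , _ , (_ , e) , _) (_ , _ , _ , _ , (_ , e′) , _) → trans (sym e) e′)
    (λ r₂ → size-⋃ (r₂ + 2) n
      (λ ((_ , e) , _) ((_ , e′) , _) → trans (sym e) e′)
      (size-cell n r₂)))

-- Mutually abelian-unbordered pairs

module _ {w z : Word} (∣w∣≡∣z∣ : length w ≡ length z) (w≁z : ¬ w ∼abl z) where

  -- The remainders have equal length, so if one were empty both would be, and the equivalence would
  -- hold between `w` and `z` themselves. This supplies the properness that borders demand.
  proper-prefixes : ∀ x x′ y y′ → w ≡ x ++ x′ → z ≡ y ++ y′ → x ∼abl y →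
                    x′ ≢ [] × y′ ≢ []
  proper-prefixes x x′ y y′ refl refl s =
    (λ e → whole e (length-≡-[] ∣x′∣≡∣y′∣ e)) ,
    (λ e → whole (length-≡-[] (sym ∣x′∣≡∣y′∣) e) e)
    where
    ∣x′∣≡∣y′∣ : length x′ ≡ length y′
    ∣x′∣≡∣y′∣ = ℕ.+-cancelˡ-≡ (length x) _ _
      (trans (sym (length-++ x))
        (trans ∣w∣≡∣z∣ (trans (length-++ y) (cong (_+ length y′) (sym (∼⇒length x y s))))))

    whole : x′ ≡ [] → ¬ y′ ≡ []
    whole refl refl = w≁z (subst₂ _∼abl_ (sym (++-identityʳ x)) (sym (++-identityʳ y)) s)

  proper-suffixes : ∀ x x′ y y′ → w ≡ x ++ x′ → z ≡ y ++ y′ → x′ ∼abl y′ →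
                    x ≢ [] × y ≢ []
  proper-suffixes x x′ y y′ refl refl s =
    (λ e → whole e (length-≡-[] ∣x∣≡∣y∣ e)) ,
    (λ e → whole (length-≡-[] (sym ∣x∣≡∣y∣) e) e)
    where
    ∣x∣≡∣y∣ : length x ≡ length y
    ∣x∣≡∣y∣ = ℕ.+-cancelʳ-≡ (length x′) _ _
      (trans (sym (length-++ x))
        (trans ∣w∣≡∣z∣ (trans (length-++ y) (cong (λ k → length y + k) (sym (∼⇒length x′ y′ s))))))

    whole : x ≡ [] → ¬ y ≡ []
    whole refl refl = w≁z s

reverse-≢[] : ∀ {A : Set} {x : List A} → x ≢ [] → reverse x ≢ []
reverse-≢[] x≢[] e = x≢[] (reverse-injective e)

unreverse : ∀ {A : Set} {v : List A} x y → reverse v ≡ x ++ y → v ≡ reverse y ++ reverse x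
unreverse {v = v} x y e =
  trans (sym (reverse-involutive v)) (trans (cong reverse e) (reverse-++ x y))

-- Reversal turns suffixes of `v` into prefixes of `reverse v` and vice versa. External borders thus
-- become equivalent prefixes, and internal borders equivalent suffixes.
mau⇔unmatched : ∀ u v → length u ≡ length v → ¬ u ∼abl v →
                MAU u v ⇔ Unmatched u (reverse v)
mau⇔unmatched u v ∣u∣≡∣v∣ u≁v = mk⇔ unmatched mau
  where
  ∣u∣≡∣vᴿ∣ : length u ≡ length (reverse v)
  ∣u∣≡∣vᴿ∣ = trans ∣u∣≡∣v∣ (sym (length-reverse v))

  u≁vᴿ : ¬ u ∼abl reverse v
  u≁vᴿ s = u≁v (λ c → trans (s c) (occ-reverse c v))

  unmatched : MAU u v → Unmatched u (reverse v)
  unmatched (¬internal , ¬external) = prefixFree , suffixFree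
    where
    prefixFree : PrefixFree u (reverse v)
    prefixFree x x′ y y′ u≡ vᴿ≡ s with []? x
    ... | yes x≡[] = x≡[]
    ... | no  x≢[] with x′≢[] , y′≢[] ← proper-prefixes ∣u∣≡∣vᴿ∣ u≁vᴿ x x′ y y′ u≡ vᴿ≡ s =
      contradiction
        ((x , reverse y) , x≢[] , (x′ , x′≢[] , u≡) ,
         (reverse y′ , reverse-≢[] y′≢[] , unreverse y y′ vᴿ≡) ,
         λ c → trans (s c) (sym (occ-reverse c y)))
        ¬external

    suffixFree : SuffixFree u (reverse v)
    suffixFree x x′ y y′ u≡ vᴿ≡ s with []? x′
    ... | yes x′≡[] = x′≡[]
    ... | no  x′≢[] with x≢[] , y≢[] ← proper-suffixes ∣u∣≡∣vᴿ∣ u≁vᴿ x x′ y y′ u≡ vᴿ≡ s =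
      contradiction
        ((x′ , reverse y′) , x′≢[] , (x , x≢[] , u≡) ,
         (reverse y , reverse-≢[] y≢[] , unreverse y y′ vᴿ≡) ,
         λ c → trans (s c) (sym (occ-reverse c y′)))
        ¬internal

  mau : Unmatched u (reverse v) → MAU u v
  mau (prefixFree , suffixFree) = ¬internal , ¬external
    where
    ¬internal : ¬ ∃ (InternalBorder u v)
    ¬internal ((x , y) , x≢[] , (x₀ , _ , u≡) , (y₀ , _ , refl) , s) =
      x≢[] (suffixFree x₀ x (reverse y₀) (reverse y) u≡ (reverse-++ y y₀)
             (λ c → trans (s c) (sym (occ-reverse c y))))

    ¬external : ¬ ∃ (ExternalBorder u v)
    ¬external ((x , y) , x≢[] , (x₀ , _ , u≡) , (y₀ , _ , refl) , s) =
      x≢[] (prefixFree x x₀ (reverse y) (reverse y₀) u≡ (reverse-++ y₀ y)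
             (λ c → trans (s c) (sym (occ-reverse c y))))

reverse₂ : Word × Word → Word × Word
reverse₂ = map₂ reverse

reverse₂-involutive : ∀ x → reverse₂ (reverse₂ x) ≡ x
reverse₂-involutive (u , v) = cong (u ,_) (reverse-involutive v)

-- The two halves are told apart by which of `u` and `reverse v` has more letters `a`. Writing them
-- as preimages under `reverse₂` and `swap` lets `size-preimage` count both from `Ordered n`.
𝓜̄≠-ordered : ∀ n → (Ordered n ∪ Ordered n ∘ swap) ∘ reverse₂ ≐ 𝓜̄≠ n
𝓜̄≠-ordered n = mau , order
  where
  differ : ∀ {u v} → occ a u ≢ occ a v → length u ≡ n → length (reverse v) ≡ n →
           Unmatched u (reverse v) → 𝓜̄≠ n (u , v)
  differ {u} {v} o ∣u∣ ∣vᴿ∣ free =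
    ∣u∣ , ∣v∣ , from (mau⇔unmatched u v (trans ∣u∣ (sym ∣v∣)) (λ s → o (s a))) free , a , o
    where
    ∣v∣ = trans (sym (length-reverse v)) ∣vᴿ∣

  mau : ∀ {x} → ((Ordered n ∪ Ordered n ∘ swap) ∘ reverse₂) x → 𝓜̄≠ n x
  mau {u , v} (inj₁ (∣u∣ , ∣vᴿ∣ , free , lt)) =
    differ (ℕ.>⇒≢ (subst (_< occ a u) (occ-reverse a v) lt)) ∣u∣ ∣vᴿ∣ free
  mau {u , v} (inj₂ (∣vᴿ∣ , ∣u∣ , free , lt)) =
    differ (ℕ.<⇒≢ (subst (occ a u <_) (occ-reverse a v) lt)) ∣u∣ ∣vᴿ∣ (unmatched-sym free)

  order : ∀ {x} → 𝓜̄≠ n x → ((Ordered n ∪ Ordered n ∘ swap) ∘ reverse₂) x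
  order {u , v} (∣u∣ , ∣v∣ , free , c , o) with ℕ.<-cmp (occ a u) (occ a (reverse v))
  ... | tri< lt _ _ = inj₂ (∣vᴿ∣ , ∣u∣ , unmatched-sym free′ , lt)
    where
    ∣vᴿ∣ = trans (length-reverse v) ∣v∣
    free′ = to (mau⇔unmatched u v (trans ∣u∣ (sym ∣v∣)) (λ s → o (s c))) free
  ... | tri> _ _ gt = inj₁ (∣u∣ , ∣vᴿ∣ , free′ , gt)
    where
    ∣vᴿ∣ = trans (length-reverse v) ∣v∣
    free′ = to (mau⇔unmatched u v (trans ∣u∣ (sym ∣v∣)) (λ s → o (s c))) free
  -- Equal lengths and equal counts of `a` make `u` and `v` equivalent, against the letter `c` in
  -- which they differ.
  ... | tri≈ _ e _ =
    contradiction (length⇒∼ u v (trans ∣u∣ (sym ∣v∣)) (trans e (occ-reverse a v)) c) o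

mainTheorem12 : ∀ (n : ℕ) → n ≥ 2 →
    ∣ 𝓜̄≠ n ∣ ≡
    2 * ∑[ 0 ⋯ n ∸ 2 ] (λ r₂ → ∑[ r₂ + 2 ⋯ n ] (λ r₁ →
    ∣ 𝓝 (+ r₂ - + r₁ , + r₁ - + r₂) (+ 0 , + 0) (+ r₂ , + n - + r₂) ∣))
mainTheorem12 n n≥2 = sym (size-unique (𝓜̄≠-ordered n)
  (size-preimage reverse₂
    (λ {x} {y} e → trans (sym (reverse₂-involutive x))
                     (trans (cong reverse₂ e) (reverse₂-involutive y)))
    (λ {y} _ → reverse₂ y , reverse₂-involutive y)
    (size-∪ (λ (_ , _ , _ , lt) (_ , _ , _ , gt) → ℕ.<-asym lt gt)
      ordered
      -- `2 * k` unfolds to `k + (k + 0)`, so the second half is given the size `k + 0`.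
      (map₂ (λ e → trans e (sym (ℕ.+-identityʳ _)))
        (size-preimage swap (cong swap) (λ {y} _ → swap y , refl) ordered))))
  (𝓜̄≠-finite , refl))
  where
  ordered = size-ordered n n≥2
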